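{- Consider SALIQUANT. Then $\mathcal{SG}(0)=0$, and if $n$ is odd, then $\mathcal{SG}(n)=\frac{n-1}{2}$. Moreover, $\mathcal{SG}(n)<n/2$.
   Context: SALIQUANT is the impartial normal-play game on the nonnegative integers where from $n$ a player subtracts a nondivisor of $n$: $\mathrm{opt}(n)=\{n-k: 1\le k\le n,\ k\nmid n\}$; the player unable to move loses. $\mathcal{SG}$ denotes the Sprague-Grundy value (mex rule).
   Formalization: The bound SG(n) < n/2 is stated for n ≥ 1 only, since at n = 0 it would read 0 < 0 and contradict SG(0) = 0. -}

module Defs where

open import Data.List.Base using (List; map; filter; upTo)
open import Data.List.Extrema.Nat using (max; xs≤max)
open import Data.List.Membership.DecPropositional using (_∈?_)
open import Data.List.Membership.Propositional using (_∈_; _∉_; mapWith∈)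
open import Data.List.Membership.Propositional.Properties using (∈-map⁺; ∈-map⁻; ∈-filter⁺; ∈-filter⁻; ∈-upTo⁺; ∈-upTo⁻; mapWith∈-cong; mapWith∈≗map)
open import Data.List.Relation.Unary.All using () renaming (lookup to All-lookup)
open import Data.Nat.Base using (ℕ; zero; suc; _+_; _∸_; _≤_; _<_; z≤n; s≤s)
open import Data.Nat.Divisibility using (_∤_; _∣?_)
open import Data.Nat.Induction using (<-rec; <-wellFounded; <-Rec)
open import Data.Nat.Properties using (_≟_; <-irrefl; m≤n⇒m<n∨m≡n; +-suc; +-identityʳ; <⇒≱; ∸-monoʳ-<)
open import Data.Product.Base using (_×_; _,_; ∃-syntax)
open import Data.Sum.Base using (inj₁; inj₂)
open import Function.Base using (_∘_)
open import Function.Bundles using (_⇔_; mk⇔; module Equivalence)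
open import Induction.WellFounded using (module FixPoint)
open import Relation.Binary.PropositionalEquality using (_≡_; refl; sym; trans; cong; subst)
open import Relation.Nullary.Decidable using (yes; no; ¬?)
open import Relation.Nullary.Negation using (contradiction)

nondivisors : ℕ → List ℕ
nondivisors n = filter (λ k → ¬? (k ∣? n)) (map suc (upTo n))

opt : ℕ → List ℕ
opt n = map (n ∸_) (nondivisors n)

∈-opt : ∀ {m n} → m ∈ opt n ⇔ (∃[ k ] 1 ≤ k × k ≤ n × k ∤ n × m ≡ n ∸ k)
∈-opt {m} {n} = mk⇔ to from
  where
  P? = λ k → ¬? (k ∣? n)

  to : m ∈ opt n → ∃[ k ] 1 ≤ k × k ≤ n × k ∤ n × m ≡ n ∸ k
  to m∈ with k , k∈ , m≡ ← ∈-map⁻ (n ∸_) m∈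
        with k∈′ , k∤n ← ∈-filter⁻ P? {xs = map suc (upTo n)} k∈
        with i , i∈ , refl ← ∈-map⁻ suc k∈′
        = suc i , s≤s z≤n , ∈-upTo⁻ i∈ , k∤n , m≡

  from : ∃[ k ] 1 ≤ k × k ≤ n × k ∤ n × m ≡ n ∸ k → m ∈ opt n
  from (suc i , _ , i<n , k∤n , refl) =
    ∈-map⁺ (n ∸_) (∈-filter⁺ P? (∈-map⁺ suc (∈-upTo⁺ i<n)) k∤n)

opt-< : ∀ {m n} → m ∈ opt n → m < n
opt-< m∈ with suc i , 1≤k , k≤n , _ , refl ← Equivalence.to ∈-opt m∈
         = ∸-monoʳ-< 1≤k k≤n

-- Linear search for the first non-member of xs among k, k + 1, …, k + b.
search : List ℕ → (k b : ℕ) → ℕ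
search xs k zero    = k
search xs k (suc b) with _∈?_ _≟_ k xs
... | yes _ = search xs (suc k) b
... | no  _ = k

-- 1 + max xs is never a member, so the search always succeeds; see mex-∉ and
-- mex-least.
mex : List ℕ → ℕ
mex xs = search xs 0 (suc (max 0 xs))

mex-∉ : ∀ xs → mex xs ∉ xs
mex-∉ xs = go 0 (suc (max 0 xs)) λ h → <-irrefl refl (All-lookup (xs≤max 0 xs) h)
  where
  go : ∀ k b → k + b ∉ xs → search xs k b ∉ xs
  go k zero    h rewrite +-identityʳ k = h
  go k (suc b) h with _∈?_ _≟_ k xs
  ... | yes _   = go (suc k) b (h ∘ subst (_∈ xs) (sym (+-suc k b)))
  ... | no  k∉  = k∉

mex-least : ∀ xs {j} → j < mex xs → j ∈ xs
mex-least xs = go 0 (suc (max 0 xs)) z≤n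
  where
  go : ∀ k b {j} → k ≤ j → j < search xs k b → j ∈ xs
  go k zero    k≤j j<k = contradiction k≤j (<⇒≱ j<k)
  go k (suc b) k≤j j<s with _∈?_ _≟_ k xs
  ... | no  _  = contradiction k≤j (<⇒≱ j<s)
  ... | yes k∈ with m≤n⇒m<n∨m≡n k≤j
  ...   | inj₁ k<j  = go (suc k) b k<j j<s
  ...   | inj₂ refl = k∈

SG-step : ∀ n → <-Rec (λ _ → ℕ) n → ℕ
SG-step n rec = mex (mapWith∈ (opt n) λ m∈ → rec (opt-< m∈))

SG : ℕ → ℕ
SG = <-rec (λ _ → ℕ) SG-step

SG-unfold : ∀ n → SG n ≡ mex (map SG (opt n))
SG-unfold n = trans
  (FixPoint.unfold-wfRec <-wellFounded (λ _ → ℕ) SG-step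
    (λ x ext → cong mex (mapWith∈-cong (opt x) _ _ (λ m∈ → ext (opt-< m∈)))) {n})
  (cong mex (mapWith∈≗map SG (opt n)))

{-# OPTIONS --safe #-}
-- A move never subtracts 1 or n, so every option m of n satisfies 1 ≤ m ≤ n − 2.
-- Inductively the options have values below (n − 2)/2, which gives 2 SG(n) < n.
-- If n is odd, every even number up to n − 1 is a nondivisor, so all smaller odd
-- numbers are options; their values 0, 1, …, (n − 3)/2 give the lower bound.
module Submission where

open import Defs using (SG)
open import Data.Integer.Base using (+_)
open import Data.Nat.Base using (ℕ; _∸_; _/_; _≤_)
open import Data.Nat.Divisibility using (_∤_)
open import Data.Product.Base using (_×_)
open import Data.Rational.Unnormalised.Base as ℚᵘ using ()
open import Relation.Binary.PropositionalEquality using (_≡_)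

open import Defs using (opt; ∈-opt; opt-<; mex-∉; mex-least; SG-unfold)
open import Data.Integer.Base as ℤ using (+<+)
open import Data.Integer.Properties using (pos-*)
open import Data.List.Base using (map)
open import Data.List.Membership.Propositional using (_∈_; _∉_)
open import Data.List.Membership.Propositional.Properties using (∈-map⁺; ∈-map⁻)
open import Data.Nat.Base using (zero; suc; _+_; _*_; _<_; z≤n; s≤s; z<s)
open import Data.Nat.Divisibility using (_∣_; divides; divides-refl; ∣-refl; ∣-trans; 1∣_; ∣m+n∣m⇒∣n; n∣m*n)
open import Data.Nat.DivMod using (m*n/n≡m)
open import Data.Nat.Induction using (<-rec)
open import Data.Nat.Properties
open import Data.Product.Base using (_,_; ∃-syntax)
open import Data.Rational.Unnormalised.Base using (*<*)
open import Data.Sum.Base using (inj₁; inj₂)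
open import Function.Bundles using (module Equivalence)
open import Relation.Binary.PropositionalEquality using (refl; sym; trans; cong; subst; subst₂)
open import Relation.Nullary.Negation using (contradiction)

SG∉SG-opt : ∀ n → SG n ∉ map SG (opt n)
SG∉SG-opt n = subst (_∉ map SG (opt n)) (sym (SG-unfold n)) (mex-∉ _)

<SG⇒∈SG-opt : ∀ n {j} → j < SG n → j ∈ map SG (opt n)
<SG⇒∈SG-opt n j<SG = mex-least _ (subst (_ <_) (SG-unfold n) j<SG)

-- Since `n` divides itself, no move reaches 0. The induction in `SG*2<n` relies on this, because
-- its bound fails at 0.
opt-positive : ∀ {m n} → m ∈ opt n → 1 ≤ m
opt-positive m∈ with k , _ , k≤n , k∤n , refl ← Equivalence.to ∈-opt m∈
                with m≤n⇒m<n∨m≡n k≤n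
... | inj₁ k<n  = m<n⇒0<n∸m k<n
... | inj₂ refl = contradiction ∣-refl k∤n

opt-gap : ∀ {m n} → m ∈ opt n → 2 + m ≤ n
opt-gap {n = n} m∈ with Equivalence.to ∈-opt m∈
... | 1           , _ , _   , k∤n , _    = contradiction (1∣ n) k∤n
... | suc (suc k) , _ , k≤n , _   , refl = begin
  2 + (n ∸ (2 + k))       ≤⟨ +-monoˡ-≤ _ (m≤m+n 2 k) ⟩
  2 + k + (n ∸ (2 + k))   ≡⟨ m+[n∸m]≡n k≤n ⟩
  n                       ∎
  where open ≤-Reasoning

SG*2<n : ∀ n → 1 ≤ n → SG n * 2 < n
SG*2<n = <-rec _ step
  where
  step : ∀ n → (∀ {m} → m < n → 1 ≤ m → SG m * 2 < m) → 1 ≤ n → SG n * 2 < n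
  step n rec 1≤n = bound (SG n) (<SG⇒∈SG-opt n)
    where
    -- `s` stands for `SG n`, to allow case analysis on it. If it is `suc s`, some option `m` has
    -- value `s`, so `s * 2 < m` by induction, and `2 + m ≤ n` gives `suc s * 2 < n`.
    bound : ∀ s → (∀ {j} → j < s → j ∈ map SG (opt n)) → s * 2 < n
    bound zero    _     = 1≤n
    bound (suc s) below with m , m∈ , refl ← ∈-map⁻ SG (below (n<1+n s))
      = ≤-trans (s≤s (s≤s (rec (opt-< m∈) (opt-positive m∈)))) (opt-gap m∈)

2∤1+a*2 : ∀ a → 2 ∤ 1 + a * 2
2∤1+a*2 zero    (divides (suc _) ())
2∤1+a*2 (suc a) 2∣ = 2∤1+a*2 a (∣m+n∣m⇒∣n (subst (2 ∣_) (sym (+-suc 2 (a * 2))) 2∣) ∣-refl)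

odd-form : ∀ n → 2 ∤ n → ∃[ a ] n ≡ 1 + a * 2
odd-form zero          2∤n = contradiction (divides-refl 0) 2∤n
odd-form (suc zero)    _   = 0 , refl
odd-form (suc (suc n)) 2∤n
  with a , refl ← odd-form n (λ { (divides q refl) → 2∤n (divides-refl (suc q)) })
  = suc a , refl

-- The move subtracts the even number `(a ∸ b) * 2`; if it divided `1 + a * 2`, so would 2.
odd∈opt-odd : ∀ {a b} → b < a → 1 + b * 2 ∈ opt (1 + a * 2)
odd∈opt-odd {a} {b} b<a = Equivalence.from ∈-opt
  ( (a ∸ b) * 2
  , *-mono-≤ (m<n⇒0<n∸m b<a) (s≤s z≤n)
  , d≤n
  , (λ d∣n → 2∤1+a*2 a (∣-trans (n∣m*n (a ∸ b)) d∣n))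
  , sym (trans (cong (1 + a * 2 ∸_) (*-distribʳ-∸ 2 a b)) difference)
  )
  where
  b*2≤a*2 : b * 2 ≤ a * 2
  b*2≤a*2 = *-monoˡ-≤ 2 (<⇒≤ b<a)
  d≤n : (a ∸ b) * 2 ≤ 1 + a * 2
  d≤n = m≤n⇒m≤1+n (*-monoˡ-≤ 2 (m∸n≤m a b))
  difference : 1 + a * 2 ∸ (a * 2 ∸ b * 2) ≡ 1 + b * 2
  difference = trans (+-∸-assoc 1 (m∸n≤m (a * 2) (b * 2))) (cong suc (m∸[m∸n]≡n b*2≤a*2))

SG-odd : ∀ a → SG (1 + a * 2) ≡ a
SG-odd = <-rec _ λ a rec →
  -- The general bound reads `SG (1 + a * 2) * 2 < 1 + a * 2`; halve it.
  let s≤a = *-cancelʳ-≤ (SG (1 + a * 2)) a 2 (m<1+n⇒m≤n (SG*2<n (1 + a * 2) z<s))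
  -- If the value `s` were below `a`, then `1 + s * 2` would be an option, with value `s` by
  -- induction, contradicting that a mex is not among the option values.
  in  ≤-antisym s≤a (≮⇒≥ λ s<a → SG∉SG-opt (1 + a * 2)
        (subst (_∈ map SG (opt (1 + a * 2))) (rec s<a) (∈-map⁺ SG (odd∈opt-odd s<a))))

mainTheorem5 : (SG 0 ≡ 0)
    × (∀ (n : ℕ) → 2 ∤ n → SG n ≡ (n ∸ 1) / 2)
    × (∀ (n : ℕ) → 1 ≤ n → (+ SG n) ℚᵘ./ 1 ℚᵘ.< (+ n) ℚᵘ./ 2)
mainTheorem5 = refl , odd , half
  where
  odd : ∀ n → 2 ∤ n → SG n ≡ (n ∸ 1) / 2
  odd n 2∤n with a , refl ← odd-form n 2∤n = trans (SG-odd a) (sym (m*n/n≡m a 2))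

  half : ∀ n → 1 ≤ n → (+ SG n) ℚᵘ./ 1 ℚᵘ.< (+ n) ℚᵘ./ 2
  -- Cross-multiplied, the rational inequality is `SG n * 2 < n * 1` over the integers.
  half n 1≤n = *<* (subst₂ ℤ._<_ (pos-* (SG n) 2) (pos-* n 1)
    (+<+ (subst (SG n * 2 <_) (sym (*-identityʳ n)) (SG*2<n n 1≤n))))
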